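{- Let $n\geq 4$ and $k$ be integers with $1 \leq k \leq n/2$. Then the expanding constant of the generalised Petersen graph $P(n,k)$ satisfies $$h(P(n,k)) < \sqrt{ \frac{24 \pi}{[n^{1/2}]-1}},$$ where $[x]$ denotes the integer part of $x$.
   Context: For positive integers $n \geq 3$ and $k \leq n/2$, the generalised Petersen graph $P(n,k)$ is the graph with vertex set $\{a_i, b_i : 0 \leq i \leq n-1\}$ (so $2n$ vertices) and edges $a_i a_{i+1}$, $a_i b_i$, $b_i b_{i+k}$ for $0 \leq i \leq n-1$, with subscripts read modulo $n$. When $k=n/2$, the edges $b_ib_{i+k}$ and $b_{i+k}b_{i+2k}=b_{i+k}b_i$ are counted separately, so that $b_i$ and $b_{i+k}$ are joined by a double edge. With this convention $P(n,k)$ is always connected and cubic ($3$-regular). The expanding constant of a finite graph $X$ with vertex set $V$ is $$h(X) = \min_{0 < |F| \leq |V|/2} \frac{|\partial F|}{|F|},$$ where $F$ ranges over the subsets of $V$ and $\partial F$ is the set of edges (counted with multiplicity) connecting a vertex in $F$ to a vertex not in $F$. -}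

module Defs where

open import Data.Empty using (⊥; ⊥-elim)
open import Data.Fin.Base as Fin using (Fin; toℕ; _↑ˡ_; _↑ʳ_)
open import Data.Fin.Subset using (Subset; Side; inside; outside; ⁅_⁆; _∈_; _∉_; ∣_∣)
open import Data.Fin.Subset.Properties using (_∈?_; ∣⁅x⁆∣≡1)
open import Data.Integer.Base as ℤ using (ℤ; +_; -1ℤ; 1ℤ)
import Data.Integer.Properties as ℤP
open import Data.List.Base using (List; []; _∷_; _++_; map; mapMaybe; filter; length; foldr; tabulate)
open import Data.List.Membership.Propositional using () renaming (_∈_ to _∈ₗ_)
open import Data.List.Membership.Propositional.Properties using (∈-map⁺; ∈-map⁻; ∈-++⁺ˡ; ∈-++⁺ʳ)
open import Data.List.Relation.Unary.Any using (here; there)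
open import Data.Maybe.Base as Maybe using (Maybe; just; nothing)
open import Data.Nat.Base as ℕ using (ℕ; zero; suc; z≤n; s≤s)
open import Data.Nat.DivMod using (_mod_)
import Data.Nat.Properties as ℕP
import Data.Nat.Tactic.RingSolver as ℕRing
open import Data.Product.Base using (∃; ∃-syntax; _×_; _,_; proj₁; proj₂)
open import Data.Rational.Base
  using (ℚ; mkℚ; 0ℚ; 1ℚ; Positive; positive; nonNegative; nonPositive; toℚᵘ;
         _<_; _≤_; _+_; _-_; -_; _*_; _/_; 1/_; _⊔_; _⊓_)
open import Data.Rational.Properties
import Data.Rational.Unnormalised.Base as ℚᵘ
import Data.Rational.Unnormalised.Properties as ℚᵘP
open import Data.Rational.Solver using (module +-*-Solver)
open import Data.Sum.Base using (_⊎_; inj₁; inj₂)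
open import Data.Vec.Base using ([]; _∷_)
open import Relation.Binary.PropositionalEquality
open import Relation.Nullary using (¬_; Dec; yes; no)
open import Relation.Nullary.Decidable using (dec⇒maybe; _×-dec_; _⊎-dec_; ¬?)

-- Edges are a list of endpoint pairs, so repeated entries are parallel
-- edges; the order within a pair is irrelevant.
record Multigraph : Set where
  field
    order : ℕ
    edges : List (Fin order × Fin order)

open Multigraph public

Crosses : ∀ {v} → Subset v → Fin v × Fin v → Set
Crosses F (x , y) = (x ∈ F × y ∉ F) ⊎ (x ∉ F × y ∈ F)

crosses? : ∀ {v} (F : Subset v) (e : Fin v × Fin v) → Dec (Crosses F e)
crosses? F (x , y) =
  ((x ∈? F) ×-dec ¬? (y ∈? F)) ⊎-dec (¬? (x ∈? F) ×-dec (y ∈? F))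

∂ : (X : Multigraph) → Subset (order X) → List (Fin (order X) × Fin (order X))
∂ X F = filter (crosses? F) (edges X)

Admissible : (X : Multigraph) → Subset (order X) → Set
Admissible X F = 0 ℕ.< ∣ F ∣ × 2 ℕ.* ∣ F ∣ ℕ.≤ order X

admissible? : (X : Multigraph) (F : Subset (order X)) → Dec (Admissible X F)
admissible? X F = (0 ℕP.<? ∣ F ∣) ×-dec (2 ℕ.* ∣ F ∣ ℕP.≤? order X)

ratio : (X : Multigraph) → ∃ (Admissible X) → ℚ
ratio X (F , 0<∣F∣ , _) = (+ length (∂ X F) / ∣ F ∣) {{ℕ.>-nonZero 0<∣F∣}}

subsets : ∀ v → List (Subset v)
subsets zero    = [] ∷ []
subsets (suc v) = map (inside ∷_) (subsets v) ++ map (outside ∷_) (subsets v)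

admissibles : (X : Multigraph) → List (∃ (Admissible X))
admissibles X =
  mapMaybe (λ F → Maybe.map (F ,_) (dec⇒maybe (admissible? X F))) (subsets (order X))

-- The value on [] is junk.
minimum : List ℚ → ℚ
minimum []       = 0ℚ
minimum (x ∷ xs) = foldr _⊓_ x xs

-- Meaningful when there are at least two vertices; see
-- expandingConstant-isMinimum.
expandingConstant : Multigraph → ℚ
expandingConstant X = minimum (map (ratio X) (admissibles X))

private
  foldr-⊓-≤ : ∀ x xs {y} → y ∈ₗ x ∷ xs → foldr _⊓_ x xs ≤ y
  foldr-⊓-≤ x []       (here refl) = ≤-refl
  foldr-⊓-≤ x (z ∷ xs) (here refl) =
    ≤-trans (p⊓q≤q z (foldr _⊓_ x xs)) (foldr-⊓-≤ x xs (here refl))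
  foldr-⊓-≤ x (z ∷ xs) (there (here refl)) = p⊓q≤p z (foldr _⊓_ x xs)
  foldr-⊓-≤ x (z ∷ xs) (there (there i)) =
    ≤-trans (p⊓q≤q z (foldr _⊓_ x xs)) (foldr-⊓-≤ x xs (there i))

  foldr-⊓-∈ : ∀ x xs → foldr _⊓_ x xs ∈ₗ x ∷ xs
  foldr-⊓-∈ x []       = here refl
  foldr-⊓-∈ x (z ∷ xs) with ⊓-sel z (foldr _⊓_ x xs) | foldr-⊓-∈ x xs
  ... | inj₁ e | _         = there (here e)
  ... | inj₂ e | here e′   = here (trans e e′)
  ... | inj₂ e | there i   = there (there (subst (_∈ₗ xs) (sym e) i))

  minimum-≤ : ∀ xs {y} → y ∈ₗ xs → minimum xs ≤ y
  minimum-≤ (x ∷ xs) i = foldr-⊓-≤ x xs i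

  minimum-∈ : ∀ xs {y} → y ∈ₗ xs → minimum xs ∈ₗ xs
  minimum-∈ (x ∷ xs) _ = foldr-⊓-∈ x xs

  subsets-complete : ∀ {v} (F : Subset v) → F ∈ₗ subsets v
  subsets-complete []            = here refl
  subsets-complete (inside  ∷ F) = ∈-++⁺ˡ (∈-map⁺ _ (subsets-complete F))
  subsets-complete (outside ∷ F) =
    ∈-++⁺ʳ (map (inside ∷_) (subsets _)) (∈-map⁺ _ (subsets-complete F))

  mapMaybe-∈ : ∀ {A B : Set} (f : A → Maybe B) {x y} xs →
               x ∈ₗ xs → f x ≡ just y → y ∈ₗ mapMaybe f xs
  mapMaybe-∈ f (x ∷ xs) (here refl) eq with f x | eq
  ... | just _ | refl = here refl
  mapMaybe-∈ f (z ∷ xs) (there i) eq with f z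
  ... | just _  = there (mapMaybe-∈ f xs i eq)
  ... | nothing = mapMaybe-∈ f xs i eq

  admissibles-complete : ∀ X (c : ∃ (Admissible X)) → c ∈ₗ admissibles X
  admissibles-complete X (F , a) =
    mapMaybe-∈ _ (subsets (order X)) (subsets-complete F)
      (found (admissible? X F))
    where
    found : (d : Dec (Admissible X F)) → Maybe.map (F ,_) (dec⇒maybe d) ≡ just (F , a)
    found (no ¬a) = ⊥-elim (¬a a)
    found (yes (a₁ , a₂)) =
      cong₂ (λ u w → just (F , u , w))
        (ℕP.≤-irrelevant a₁ (proj₁ a)) (ℕP.≤-irrelevant a₂ (proj₂ a))

  singletonAdmissible : ∀ X → 2 ℕ.≤ order X → ∃ (Admissible X)
  singletonAdmissible record { order = suc v } 2≤ =
    ⁅ Fin.zero ⁆ ,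
    subst (0 ℕ.<_) (sym (∣⁅x⁆∣≡1 {suc v} Fin.zero)) (s≤s z≤n) ,
    subst (λ c → 2 ℕ.* c ℕ.≤ suc v) (sym (∣⁅x⁆∣≡1 {suc v} Fin.zero)) 2≤

expandingConstant-isMinimum : ∀ X → 2 ℕ.≤ order X →
  (∃[ c ] expandingConstant X ≡ ratio X c) × (∀ c → expandingConstant X ≤ ratio X c)
expandingConstant-isMinimum X 2≤ = attained , bound
  where
  attained : ∃[ c ] expandingConstant X ≡ ratio X c
  attained with ∈-map⁻ (ratio X)
    (minimum-∈ _ (∈-map⁺ (ratio X) (admissibles-complete X (singletonAdmissible X 2≤))))
  ... | c , _ , eq = c , eq
  bound : ∀ c → expandingConstant X ≤ ratio X c
  bound c = minimum-≤ _ (∈-map⁺ (ratio X) (admissibles-complete X c))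

_⊕_ : ∀ {n} → Fin n → ℕ → Fin n
_⊕_ {suc n} i k = (toℕ i ℕ.+ k) mod suc n

-- The vertices a i and b i occupy the two halves of Fin (n + n).  For
-- 2 k = n the last family lists each inner edge twice: i and i + k both
-- contribute b i — b (i + k).
petersen : ℕ → ℕ → Multigraph
petersen n k = record
  { order = n ℕ.+ n
  ; edges = tabulate (λ i → a i , a (i ⊕ 1))
         ++ tabulate (λ i → a i , b i)
         ++ tabulate (λ i → b i , b (i ⊕ k))
  }
  where
  a b : Fin n → Fin (n ℕ.+ n)
  a i = i ↑ˡ n
  b i = n ↑ʳ i

private
  /-mono-< : ∀ i j c d → i ℤ.* + suc d ℤ.< j ℤ.* + suc c → i / suc c < j / suc d
  /-mono-< i j c d lt = toℚᵘ-cancel-<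
    (ℚᵘP.<-respˡ-≃ (ℚᵘP.≃-sym (toℚᵘ-fromℚᵘ (ℚᵘ.mkℚᵘ i c)))
      (ℚᵘP.<-respʳ-≃ (ℚᵘP.≃-sym (toℚᵘ-fromℚᵘ (ℚᵘ.mkℚᵘ j d))) (ℚᵘ.*<* lt)))

  /-mono-≤ : ∀ i j c d → i ℤ.* + suc d ℤ.≤ j ℤ.* + suc c → i / suc c ≤ j / suc d
  /-mono-≤ i j c d le = toℚᵘ-cancel-≤
    (ℚᵘP.≤-respˡ-≃ (ℚᵘP.≃-sym (toℚᵘ-fromℚᵘ (ℚᵘ.mkℚᵘ i c)))
      (ℚᵘP.≤-respʳ-≃ (ℚᵘP.≃-sym (toℚᵘ-fromℚᵘ (ℚᵘ.mkℚᵘ j d))) (ℚᵘ.*≤* le)))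

  ι : ℕ → ℚ
  ι m = + m / 1

  ι-mono-≤ : ∀ {m n} → m ℕ.≤ n → ι m ≤ ι n
  ι-mono-≤ {m} {n} le = /-mono-≤ (+ m) (+ n) 0 0
    (subst₂ ℤ._≤_ (sym (ℤP.*-identityʳ (+ m))) (sym (ℤP.*-identityʳ (+ n))) (ℤ.+≤+ le))

  ι-mono-< : ∀ {m n} → m ℕ.< n → ι m < ι n
  ι-mono-< {m} {n} lt = /-mono-< (+ m) (+ n) 0 0
    (subst₂ ℤ._<_ (sym (ℤP.*-identityʳ (+ m))) (sym (ℤP.*-identityʳ (+ n))) (ℤ.+<+ lt))

  ι-* : ∀ m n → ι (m ℕ.* n) ≡ ι m * ι n
  ι-* m n = toℚᵘ-injective (begin
    toℚᵘ (ι (m ℕ.* n))                        ≈⟨ toℚᵘ-fromℚᵘ (ℚᵘ.mkℚᵘ (+ (m ℕ.* n)) 0) ⟩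
    ℚᵘ.mkℚᵘ (+ (m ℕ.* n)) 0                   ≈⟨ ℚᵘ.*≡* (cong (ℤ._* 1ℤ) (ℤP.pos-* m n)) ⟩
    ℚᵘ.mkℚᵘ (+ m) 0 ℚᵘ.* ℚᵘ.mkℚᵘ (+ n) 0      ≈⟨ ℚᵘP.*-cong (toℚᵘ-fromℚᵘ (ℚᵘ.mkℚᵘ (+ m) 0))
                                                            (toℚᵘ-fromℚᵘ (ℚᵘ.mkℚᵘ (+ n) 0)) ⟨
    toℚᵘ (ι m) ℚᵘ.* toℚᵘ (ι n)                ≈⟨ toℚᵘ-homo-* (ι m) (ι n) ⟨
    toℚᵘ (ι m * ι n)                          ∎)
    where open ℚᵘP.≃-Reasoning

  p<q⇒0<q-p : ∀ {p q} → p < q → 0ℚ < q - p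
  p<q⇒0<q-p {p} {q} lt = subst (_< q - p) (+-inverseʳ p) (+-monoˡ-< (- p) lt)

  p≤q⇒0≤q-p : ∀ {p q} → p ≤ q → 0ℚ ≤ q - p
  p≤q⇒0≤q-p {p} {q} le = subst (_≤ q - p) (+-inverseʳ p) (+-monoˡ-≤ (- p) le)

  0≤-* : ∀ {p q} → 0ℚ ≤ p → 0ℚ ≤ q → 0ℚ ≤ p * q
  0≤-* {p} {q} 0≤p 0≤q = nonNegative⁻¹ (p * q)
    {{nonNeg*nonNeg⇒nonNeg p {{nonNegative 0≤p}} q {{nonNegative 0≤q}}}}

  p≤p+q : ∀ {p q} → 0ℚ ≤ q → p ≤ p + q
  p≤p+q {p} {q} 0≤q = subst (_≤ p + q) (+-identityʳ p) (+-monoʳ-≤ p 0≤q)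

  p<p+q : ∀ {p q} → 0ℚ < q → p < p + q
  p<p+q {p} {q} 0<q = subst (_< p + q) (+-identityʳ p) (+-monoʳ-< p 0<q)

  sq-mono-< : ∀ {p q} → 0ℚ ≤ p → p < q → p * p < q * q
  sq-mono-< {p} {q} 0≤p p<q = ≤-<-trans
    (*-monoˡ-≤-nonNeg p {{nonNegative 0≤p}} (<⇒≤ p<q))
    (*-monoˡ-<-pos q {{positive (≤-<-trans 0≤p p<q)}} p<q)

  sq-mono-≤ : ∀ {p q} → 0ℚ ≤ p → p ≤ q → p * p ≤ q * q
  sq-mono-≤ {p} {q} 0≤p p≤q = ≤-trans
    (*-monoˡ-≤-nonNeg p {{nonNegative 0≤p}} p≤q)
    (*-monoʳ-≤-nonNeg q {{nonNegative (≤-trans 0≤p p≤q)}} p≤q)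

  sq-nonNeg : ∀ p → 0ℚ ≤ p * p
  sq-nonNeg p with ≤-total 0ℚ p
  ... | inj₁ 0≤p = 0≤-* 0≤p 0≤p
  ... | inj₂ p≤0 = nonNegative⁻¹ (p * p)
    {{nonPos*nonPos⇒nonPos p {{nonPositive p≤0}} p {{nonPositive p≤0}}}}

  sq-large : ∀ r → ∃[ c ] 0ℚ < c × r ≤ c * c
  sq-large r = c , 0<c , ≤-trans (p≤p⊔q r 1ℚ)
    (subst (_≤ c * c) (*-identityʳ c) (*-monoˡ-≤-nonNeg c {{nonNegative (<⇒≤ 0<c)}} (p≤q⊔p r 1ℚ)))
    where
    c = r ⊔ 1ℚ
    0<c : 0ℚ < c
    0<c = <-≤-trans (positive⁻¹ 1ℚ) (p≤q⊔p r 1ℚ)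

  quotient : ∀ x d → 0ℚ < d → ∃[ s ] s * d ≡ x
  quotient x d 0<d = x * (1/ d) , trans (*-assoc x (1/ d) d)
      (trans (cong (x *_) (*-inverseˡ d)) (*-identityʳ x))
    where instance _ = pos⇒nonZero d {{positive 0<d}}

  sq-*-sq : ∀ s d → (s * s) * (d * d) ≡ (s * d) * (s * d)
  sq-*-sq = solve 2 (λ s d → (s :* s) :* (d :* d) := (s :* d) :* (s :* d)) refl
    where open +-*-Solver

  pos-* : ∀ {p q} → 0ℚ < p → 0ℚ < q → 0ℚ < p * q
  pos-* {p} {q} 0<p 0<q = positive⁻¹ (p * q)
    {{pos*pos⇒pos p {{positive 0<p}} q {{positive 0<q}}}}

  -- s is where the chord of x ↦ x² over [q , c] reaches height r
  sq-above : ∀ {q r} → 0ℚ ≤ q → q * q < r → ∃[ s ] q < s × s * s ≤ r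
  sq-above {q} {r} 0≤q q²<r with sq-large r
  ... | c , 0<c , r≤c² with quotient (q * c + r) (q + c) (+-mono-≤-< 0≤q 0<c)
  ... | s , sd≡ = s ,
      *-cancelʳ-<-nonNeg d {{nonNegative (<⇒≤ 0<d)}} (subst (q * d <_) (sym sd≡)
        (subst₂ _<_ (lhs q c) refl (+-monoʳ-< (q * c) q²<r))) ,
      *-cancelʳ-≤-pos (d * d) {{positive (pos-* 0<d 0<d)}}
        (subst₂ _≤_ (sym (trans (sq-*-sq s d) (cong₂ _*_ sd≡ sd≡))) (sym (expand q c r))
          (p≤p+q (0≤-* (p≤q⇒0≤q-p (<⇒≤ q²<r)) (p≤q⇒0≤q-p r≤c²))))
    where
    open +-*-Solver
    d = q + c
    0<d : 0ℚ < d
    0<d = +-mono-≤-< 0≤q 0<c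
    lhs : ∀ q c → q * c + q * q ≡ q * (q + c)
    lhs = solve 2 (λ q c → q :* c :+ q :* q := q :* (q :+ c)) refl
    expand : ∀ q c r → r * ((q + c) * (q + c)) ≡
             (q * c + r) * (q * c + r) + (r - q * q) * (c * c - r)
    expand = solve 3 (λ q c r → r :* ((q :+ c) :* (q :+ c)) :=
      (q :* c :+ r) :* (q :* c :+ r) :+ (r :- q :* q) :* (c :* c :- r)) refl

  -- one Newton step from q
  sq-below : ∀ {q r} → 0ℚ < q → r < q * q → ∃[ s ] 0ℚ < s × s < q × r ≤ s * s
  sq-below {q} {r₀} 0<q r₀<q² with quotient (q * q + (r₀ ⊔ 0ℚ)) (q + q) (+-mono-< 0<q 0<q)
  ... | s , sd≡ = s ,
      *-cancelʳ-<-nonNeg d {{nonNegative (<⇒≤ 0<d)}} (subst₂ _<_ (sym (*-zeroˡ d)) (sym sd≡)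
        (<-≤-trans 0<q² (p≤p+q (p≤q⊔p r₀ 0ℚ)))) ,
      *-cancelʳ-<-nonNeg d {{nonNegative (<⇒≤ 0<d)}} (subst₂ _<_ (sym sd≡) (sym (*-distribˡ-+ q q q))
        (+-monoʳ-< (q * q) r<q²)) ,
      ≤-trans (p≤p⊔q r₀ 0ℚ) (*-cancelʳ-≤-pos (d * d) {{positive (pos-* 0<d 0<d)}}
        (subst (r * (d * d) ≤_)
          (trans (sym (expand q r)) (sym (trans (sq-*-sq s d) (cong₂ _*_ sd≡ sd≡))))
          (p≤p+q (sq-nonNeg (q * q - r)))))
    where
    open +-*-Solver
    d = q + q
    r = r₀ ⊔ 0ℚ
    0<d : 0ℚ < d
    0<d = +-mono-< 0<q 0<q
    0<q² : 0ℚ < q * q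
    0<q² = pos-* 0<q 0<q
    r<q² : r < q * q
    r<q² with ⊔-sel r₀ 0ℚ
    ... | inj₁ e = subst (_< q * q) (sym e) r₀<q²
    ... | inj₂ e = subst (_< q * q) (sym e) 0<q²
    expand : ∀ q r → (q * q + r) * (q * q + r) ≡
             r * ((q + q) * (q + q)) + (q * q - r) * (q * q - r)
    expand = solve 2 (λ q r → (q :* q :+ r) :* (q :* q :+ r) :=
      r :* ((q :+ q) :* (q :+ q)) :+ (q :* q :- r) :* (q :* q :- r)) refl

  <0⊎0≤ : ∀ q → q < 0ℚ ⊎ 0ℚ ≤ q
  <0⊎0≤ q with q <? 0ℚ
  ... | yes lt = inj₁ lt
  ... | no ¬lt = inj₂ (≮⇒≥ ¬lt)

  p<p+1 : ∀ p → p < p + 1ℚ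
  p<p+1 p = p<p+q (positive⁻¹ 1ℚ)

  p-1<p : ∀ p → p - 1ℚ < p
  p-1<p p = subst (p - 1ℚ <_) (+-identityʳ p) (+-monoʳ-< p (negative⁻¹ (- 1ℚ)))

record ℝ : Set₁ where
  field
    Lower Upper     : ℚ → Set
    lower-inhabited : ∃ Lower
    upper-inhabited : ∃ Upper
    lower-closed    : ∀ {p q} → p < q → Lower q → Lower p
    upper-closed    : ∀ {p q} → p < q → Upper p → Upper q
    lower-open      : ∀ {p} → Lower p → ∃[ q ] p < q × Lower q
    upper-open      : ∀ {q} → Upper q → ∃[ p ] p < q × Upper p
    disjoint        : ∀ {q} → Lower q → Upper q → ⊥
    located         : ∀ {p q} → p < q → Lower p ⊎ Upper q

open ℝ public

infix 4 _<ℝ_ _≤ℝ_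

_<ℝ_ : ℝ → ℝ → Set
x <ℝ y = ∃[ q ] Upper x q × Lower y q

_≤ℝ_ : ℝ → ℝ → Set
x ≤ℝ y = ¬ (y <ℝ x)

fromℚ : ℚ → ℝ
fromℚ r = record
  { Lower           = _< r
  ; Upper           = r <_
  ; lower-inhabited = r - 1ℚ , p-1<p r
  ; upper-inhabited = r + 1ℚ , p<p+1 r
  ; lower-closed    = <-trans
  ; upper-closed    = λ p<q r<p → <-trans r<p p<q
  ; lower-open      = λ p<r → let q , p<q , q<r = <-dense p<r in q , p<q , q<r
  ; upper-open      = λ r<q → let p , r<p , p<q = <-dense r<q in p , p<q , r<p
  ; disjoint        = <-asym
  ; located         = loc
  }
  where
  loc : ∀ {p q} → p < q → p < r ⊎ r < q
  loc {p} p<q with p <? r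
  ... | yes p<r = inj₁ p<r
  ... | no  p≮r = inj₂ (≤-<-trans (≮⇒≥ p≮r) p<q)

fromℤ : ℤ → ℝ
fromℤ i = fromℚ (i / 1)

infixl 7 _÷_ _·_

divide : ℝ → (r : ℚ) → .{{Positive r}} → ℝ
divide x r = record
  { Lower           = λ q → Lower x (q * r)
  ; Upper           = λ q → Upper x (q * r)
  ; lower-inhabited = let l , Ll = lower-inhabited x ; s , e = quot l in s , subst (Lower x) (sym e) Ll
  ; upper-inhabited = let u , Uu = upper-inhabited x ; s , e = quot u in s , subst (Upper x) (sym e) Uu
  ; lower-closed    = λ p<q → lower-closed x (*-monoˡ-<-pos r p<q)
  ; upper-closed    = λ p<q → upper-closed x (*-monoˡ-<-pos r p<q)
  ; lower-open      = λ Lp → let t , lt , Lt = lower-open x Lp ; s , e = quot t in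
      s , cancel (subst (_ <_) (sym e) lt) , subst (Lower x) (sym e) Lt
  ; upper-open      = λ Uq → let t , lt , Ut = upper-open x Uq ; s , e = quot t in
      s , cancel (subst (_< _) (sym e) lt) , subst (Upper x) (sym e) Ut
  ; disjoint        = disjoint x
  ; located         = λ p<q → located x (*-monoˡ-<-pos r p<q)
  }
  where
  quot : ∀ y → ∃[ s ] s * r ≡ y
  quot y = quotient y r (positive⁻¹ r)
  cancel : ∀ {p q} → p * r < q * r → p < q
  cancel = *-cancelʳ-<-nonNeg r {{pos⇒nonNeg r}}

_÷_ : ℝ → (m : ℕ) → .{{ℕ.NonZero m}} → ℝ
x ÷ m = divide x (+ m / 1) {{normalize-pos m 1}}

_·_ : (m : ℕ) → .{{ℕ.NonZero m}} → ℝ → ℝ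
m · x = divide x (+ 1 / m) {{normalize-pos 1 m}}

-- Total: for x < 0 this is 0.
√ : ℝ → ℝ
√ x = record
  { Lower           = λ q → q < 0ℚ ⊎ Lower x (q * q)
  ; Upper           = λ q → 0ℚ < q × Upper x (q * q)
  ; lower-inhabited = - 1ℚ , inj₁ (negative⁻¹ (- 1ℚ))
  ; upper-inhabited = inhU
  ; lower-closed    = closedL
  ; upper-closed    = λ { p<q (0<p , Up²) →
      <-trans 0<p p<q , upper-closed x (sq-mono-< (<⇒≤ 0<p) p<q) Up² }
  ; lower-open      = openL
  ; upper-open      = openU
  ; disjoint        = λ { (inj₁ q<0) (0<q , _) → <-asym q<0 0<q
                        ; (inj₂ Lq²) (_ , Uq²) → disjoint x Lq² Uq² }
  ; located         = loc
  }
  where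
  closedL≤ : ∀ {p q} → p ≤ q → Lower x q → Lower x p
  closedL≤ {p} {q} p≤q Lq with p <? q
  ... | yes p<q = lower-closed x p<q Lq
  ... | no  p≮q = subst (Lower x) (≤-antisym (≮⇒≥ p≮q) p≤q) Lq

  closedU≤ : ∀ {p q} → p ≤ q → Upper x p → Upper x q
  closedU≤ {p} {q} p≤q Up with p <? q
  ... | yes p<q = upper-closed x p<q Up
  ... | no  p≮q = subst (Upper x) (≤-antisym p≤q (≮⇒≥ p≮q)) Up

  inhU : ∃[ q ] 0ℚ < q × Upper x (q * q)
  inhU = let u , Uu = upper-inhabited x ; c , 0<c , u≤c² = sq-large u in
    c , 0<c , closedU≤ u≤c² Uu

  closedL : ∀ {p q} → p < q → q < 0ℚ ⊎ Lower x (q * q) → p < 0ℚ ⊎ Lower x (p * p)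
  closedL p<q (inj₁ q<0) = inj₁ (<-trans p<q q<0)
  closedL {p} p<q (inj₂ Lq²) with <0⊎0≤ p
  ... | inj₁ p<0 = inj₁ p<0
  ... | inj₂ 0≤p = inj₂ (lower-closed x (sq-mono-< 0≤p p<q) Lq²)

  openL : ∀ {p} → p < 0ℚ ⊎ Lower x (p * p) → ∃[ q ] p < q × (q < 0ℚ ⊎ Lower x (q * q))
  openL {p} l with <0⊎0≤ p
  openL l          | inj₁ p<0 = let q , p<q , q<0 = <-dense p<0 in q , p<q , inj₁ q<0
  openL (inj₁ p<0) | inj₂ 0≤p = ⊥-elim (<-irrefl refl (<-≤-trans p<0 0≤p))
  openL (inj₂ Lp²) | inj₂ 0≤p =
    let r , p²<r , Lr = lower-open x Lp² ; s , p<s , s²≤r = sq-above 0≤p p²<r in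
    s , p<s , inj₂ (closedL≤ s²≤r Lr)

  openU : ∀ {q} → 0ℚ < q × Upper x (q * q) → ∃[ p ] p < q × (0ℚ < p × Upper x (p * p))
  openU (0<q , Uq²) =
    let r , r<q² , Ur = upper-open x Uq² ; s , 0<s , s<q , r≤s² = sq-below 0<q r<q² in
    s , s<q , 0<s , closedU≤ r≤s² Ur

  loc : ∀ {p q} → p < q → (p < 0ℚ ⊎ Lower x (p * p)) ⊎ (0ℚ < q × Upper x (q * q))
  loc {p} p<q with <0⊎0≤ p
  ... | inj₁ p<0 = inj₁ (inj₁ p<0)
  ... | inj₂ 0≤p with located x (sq-mono-< 0≤p p<q)
  ... | inj₁ Lp² = inj₁ (inj₂ Lp²)
  ... | inj₂ Uq² = inj₂ (≤-<-trans 0≤p p<q , Uq²)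

leibnizTerm : ℕ → ℚ
leibnizTerm i = (-1ℤ ℤ.^ i ℤ.* + 4) / suc (2 ℕ.* i)

leibnizSum : ℕ → ℚ
leibnizSum zero    = 0ℚ
leibnizSum (suc n) = leibnizSum n + leibnizTerm n

private
  δ : ℕ → ℚ
  δ i = + 4 / suc (2 ℕ.* i)

  0<δ : ∀ i → 0ℚ < δ i
  0<δ i = positive⁻¹ (δ i) {{normalize-pos 4 (suc (2 ℕ.* i))}}

  δ-decreasing : ∀ i → δ (suc i) < δ i
  δ-decreasing i = /-mono-< (+ 4) (+ 4) (2 ℕ.* suc i) (2 ℕ.* i)
    (ℤP.*-monoˡ-<-pos (+ 4) (ℤ.+<+ (s≤s (ℕP.*-monoʳ-< 2 (ℕP.n<1+n i)))))

  E O : ℕ → ℚ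
  E N = leibnizSum (2 ℕ.* N)
  O N = leibnizSum (suc (2 ℕ.* N))

  -1^2N : ∀ N → -1ℤ ℤ.^ (2 ℕ.* N) ≡ 1ℤ
  -1^2N N = trans (sym (ℤP.^-*-assoc -1ℤ 2 N)) (ℤP.^-zeroˡ N)

  termEven : ∀ N → leibnizTerm (2 ℕ.* N) ≡ δ (2 ℕ.* N)
  termEven N = cong (λ s → (s ℤ.* + 4) / suc (2 ℕ.* (2 ℕ.* N))) (-1^2N N)

  termOdd : ∀ N → leibnizTerm (suc (2 ℕ.* N)) ≡ - δ (suc (2 ℕ.* N))
  termOdd N = cong (λ s → ((-1ℤ ℤ.* s) ℤ.* + 4) / suc (2 ℕ.* suc (2 ℕ.* N))) (-1^2N N)

  O≡ : ∀ N → O N ≡ E N + δ (2 ℕ.* N)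
  O≡ N = cong (λ z → E N + z) (termEven N)

  E-suc : ∀ N → E (suc N) ≡ O N - δ (suc (2 ℕ.* N))
  E-suc N = trans (cong leibnizSum (ℕP.*-suc 2 N)) (cong (λ z → O N + z) (termOdd N))

  cancelδ : ∀ p d → p ≡ (p - d) + d
  cancelδ = solve 2 (λ p d → p := (p :- d) :+ d) refl
    where open +-*-Solver

  E<O : ∀ N → E N < O N
  E<O N = subst (E N <_) (sym (O≡ N)) (p<p+q (0<δ (2 ℕ.* N)))

  E-step : ∀ N → E N ≤ E (suc N)
  E-step N = subst (E N ≤_) (sym (trans (E-suc N) (trans (cong (_- δ (suc (2 ℕ.* N))) (O≡ N))
      (+-assoc (E N) _ _))))
    (p≤p+q (p≤q⇒0≤q-p (<⇒≤ (δ-decreasing (2 ℕ.* N)))))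

  O-step : ∀ N → O (suc N) ≤ O N
  O-step N = subst₂ _≤_ (sym (trans (O≡ (suc N)) (cong₂ _+_ (E-suc N) (cong δ (ℕP.*-suc 2 N)))))
    (sym (cancelδ (O N) (δ (suc (2 ℕ.* N)))))
    (+-monoʳ-≤ (O N - δ (suc (2 ℕ.* N))) (<⇒≤ (δ-decreasing (suc (2 ℕ.* N)))))

  E-mono : ∀ M k → E M ≤ E (k ℕ.+ M)
  E-mono M zero    = ≤-refl
  E-mono M (suc k) = ≤-trans (E-mono M k) (E-step (k ℕ.+ M))

  O-anti : ∀ M k → O (k ℕ.+ M) ≤ O M
  O-anti M zero    = ≤-refl
  O-anti M (suc k) = ≤-trans (O-step (k ℕ.+ M)) (O-anti M k)

  E<O′ : ∀ M N → E M < O N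
  E<O′ M N = ≤-<-trans (E-mono M N)
    (<-≤-trans (E<O (N ℕ.+ M)) (subst (λ k → O k ≤ O N) (ℕP.+-comm M N) (O-anti N M)))

  δ-small : ∀ r → 0ℚ < r → ∃[ N ] δ (2 ℕ.* N) < r
  δ-small r 0<r = suc b , <-≤-trans step₁ (step₂ r 0<r)
    where
    b = ℚ.denominator-1 r
    bound : ∀ b → 4 ℕ.* suc b ℕ.< 1 ℕ.* suc (2 ℕ.* (2 ℕ.* suc b))
    bound b = ℕP.≤-reflexive (eq b)
      where
      eq : ∀ b → suc (4 ℕ.* suc b) ≡ 1 ℕ.* suc (2 ℕ.* (2 ℕ.* suc b))
      eq = ℕRing.solve-∀
    step₁ : δ (2 ℕ.* suc b) < + 1 / suc b
    step₁ = /-mono-< (+ 4) (+ 1) (2 ℕ.* (2 ℕ.* suc b)) b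
      (subst₂ ℤ._<_ (ℤP.pos-* 4 (suc b)) (ℤP.pos-* 1 (suc (2 ℕ.* (2 ℕ.* suc b)))) (ℤ.+<+ (bound b)))
    step₂ : ∀ r → 0ℚ < r → + 1 / suc (ℚ.denominator-1 r) ≤ r
    step₂ r 0<r with positive 0<r
    step₂ r@(mkℚ (+ suc a) b _) 0<r | _ =
      subst (+ 1 / suc b ≤_) (↥p/↧p≡p r)
        (/-mono-≤ (+ 1) (+ suc a) b b (ℤP.*-monoʳ-≤-nonNeg (+ suc b) (ℤ.+≤+ (s≤s (z≤n {a})))))

-- π = 4 − 4/3 + 4/5 − ⋯ : the sums of an even number of terms increase to
-- π and those of an odd number of terms decrease to it.
π : ℝ
π = record
  { Lower           = λ q → ∃[ N ] q < leibnizSum (2 ℕ.* N)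
  ; Upper           = λ q → ∃[ N ] leibnizSum (suc (2 ℕ.* N)) < q
  ; lower-inhabited = - 1ℚ , 0 , negative⁻¹ (- 1ℚ)
  ; upper-inhabited = O 0 + 1ℚ , 0 , p<p+1 (O 0)
  ; lower-closed    = λ { p<q (N , q<) → N , <-trans p<q q< }
  ; upper-closed    = λ { p<q (N , <p) → N , <-trans <p p<q }
  ; lower-open      = λ { (N , p<) → let q , p<q , q< = <-dense p< in q , p<q , N , q< }
  ; upper-open      = λ { (N , <q) → let p , <p , p<q = <-dense <q in p , p<q , N , <p }
  ; disjoint        = λ { (M , q<E) (N , O<q) → <-asym (E<O′ M N) (<-trans O<q q<E) }
  ; located         = loc
  }
  where
  loc : ∀ {p q} → p < q → (∃[ N ] p < E N) ⊎ (∃[ N ] O N < q)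
  loc {p} {q} p<q with δ-small (q - p) (p<q⇒0<q-p p<q)
  ... | N , δ<q-p with p <? E N
  ... | yes p<E = inj₁ (N , p<E)
  ... | no  p≮E = inj₂ (N , subst₂ _<_ (sym (O≡ N)) (p+q-p p q) (+-mono-≤-< (≮⇒≥ p≮E) δ<q-p))
    where
    p+q-p : ∀ p q → p + (q - p) ≡ q
    p+q-p = solve 2 (λ p q → p :+ (q :- p) := q) refl
      where open +-*-Solver

IsIntegerPart : ℝ → ℤ → Set
IsIntegerPart x i = fromℤ i ≤ℝ x × x <ℝ fromℤ (ℤ.suc i)

private
  isqrt : ∀ n → ∃[ m ] m ℕ.* m ℕ.≤ n × n ℕ.< suc m ℕ.* suc m
  isqrt zero = 0 , z≤n , s≤s z≤n
  isqrt (suc n) with isqrt n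
  ... | m , m²≤n , n<m′² with suc m ℕ.* suc m ℕP.≤? suc n
  ... | yes le = suc m , le ,
        ℕP.≤-<-trans n<m′² (ℕP.*-mono-< (ℕP.n<1+n (suc m)) (ℕP.n<1+n (suc m)))
  ... | no  gt = m , ℕP.m≤n⇒m≤1+n m²≤n , ℕP.≰⇒> gt

  isqrt-isIntegerPart : ∀ n → IsIntegerPart (√ (fromℤ (+ n))) (+ proj₁ (isqrt n))
  isqrt-isIntegerPart n with isqrt n
  ... | m , m²≤n , n<m′² = lower , upper
    where
    lower : fromℤ (+ m) ≤ℝ √ (fromℤ (+ n))
    lower (q , (0<q , n<q²) , q<m) = <-irrefl refl (≤-<-trans
      (subst (_≤ ι n) (ι-* m m) (ι-mono-≤ m²≤n))
      (<-trans n<q² (sq-mono-< (<⇒≤ 0<q) q<m)))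

    upper : √ (fromℤ (+ n)) <ℝ fromℤ (+ suc m)
    upper = let q , q<m′ , Uq = upper-open (√ (fromℤ (+ n)))
                  {q = ι (suc m)}
                  (ι-mono-< {0} {suc m} (s≤s z≤n) , subst (ι n <_) (ι-* (suc m) (suc m)) (ι-mono-< n<m′²))
            in q , Uq , q<m′

integerPart√ : ∀ n → ∃[ m ] IsIntegerPart (√ (fromℤ (+ n))) (+ m)
integerPart√ n = proj₁ (isqrt n) , isqrt-isIntegerPart n

⌊√_⌋ : ℕ → ℕ
⌊√ n ⌋ = proj₁ (integerPart√ n)

⌊√n⌋∸1-nonZero : ∀ {n} → 4 ℕ.≤ n → ℕ.NonZero (⌊√ n ⌋ ℕ.∸ 1)
⌊√n⌋∸1-nonZero {n} 4≤n with isqrt n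
... | zero        , _ , n<1 = ⊥-elim (ℕP.<⇒≱ n<1 (ℕP.≤-trans (s≤s z≤n) 4≤n))
... | suc zero    , _ , n<4 = ⊥-elim (ℕP.<⇒≱ n<4 4≤n)
... | suc (suc _) , _       = _

module Submission where

-- By Dirichlet some 1 ≤ q ≤ m := ⌊√n⌋ has q k ≡ ± e (mod n) with e m < n.  Let n/4 < h ≤ n/2 be a
-- multiple of q, let S be the set of x whose residue q x mod n lies among the last h residues,
-- and let F consist of the spokes a x — b x with x ∈ S.  A step of the rim moves q x by q and an
-- inner step moves it by ± e, so an edge can only cross when q x is within q, respectively e, of
-- an end of the window.  The numbers of such x are differences of c ↦ Σ_x ⌊(q x + c)/n⌋, which
-- telescopes under c ↦ c + q; this gives |F| = 2 h and |∂F| ≤ 4 q + 2 e < 12 |F| / m.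

open import Defs
open import Data.Bool.Base using (Bool; true; false)
open import Data.Fin.Base as Fin using (Fin; toℕ; fromℕ<; _↑ˡ_; _↑ʳ_)
open import Data.Fin.Properties using (pigeonhole; toℕ<n; toℕ-fromℕ<)
open import Data.Fin.Subset using (Subset; ∣_∣)
import Data.Integer.Base as ℤ
import Data.Integer.Properties as ℤP
open import Data.List.Base as List using (filter; length)
open import Data.List.Properties using (filter-++; length-++)
open import Data.Nat using
  (ℕ; zero; suc; _≤_; _<_; _+_; _*_; _∸_; z≤n; s≤s; NonZero; ∣_-_∣; >-nonZero; >-nonZero⁻¹; ≢-nonZero⁻¹)
open import Data.Nat.Divisibility using (divides-refl)
open import Data.Nat.DivMod using
  (_/_; _%_; m≡m%n+[m/n]*n; m%n<n; m%n≤n; m%n%n≡m%n; [m+kn]%n≡m%n; m*n%n≡0; m*n/n≡m; m/n*n≤m;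
   m≥n⇒m/n>0; m<n*o⇒m/o<n; /-monoˡ-≤; +-distrib-/-∣ʳ; %-distribˡ-+; %-distribˡ-*)
open import Data.Nat.Properties
open import Data.Nat.Tactic.RingSolver using (solve-∀)
open import Data.Product.Base using (∃-syntax; _×_; _,_; proj₁; proj₂)
import Data.Rational.Base as ℚ
import Data.Rational.Properties as ℚP
import Data.Rational.Unnormalised.Base as ℚᵘ
import Data.Rational.Unnormalised.Properties as ℚᵘP
open import Data.Sum.Base using (_⊎_; inj₁; inj₂)
open import Data.Vec.Base as Vec using ([]; _∷_; lookup; _++_)
open import Data.Vec.Properties using ([]=⇒lookup; lookup⇒[]=; lookup-++ˡ; lookup-++ʳ; lookup∘tabulate)
open import Function.Base using (_∘_)
open import Relation.Binary.PropositionalEquality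
open import Relation.Nullary using (yes; no; does; contradiction)
open import Relation.Unary using (Decidable)

-- Finite sums and elementary arithmetic of quotients and residues.

∑ : ℕ → (ℕ → ℕ) → ℕ
∑ zero    f = 0
∑ (suc n) f = f 0 + ∑ n (f ∘ suc)

∑-cong : ∀ n {f g} → (∀ x → f x ≡ g x) → ∑ n f ≡ ∑ n g
∑-cong zero    f≗g = refl
∑-cong (suc n) f≗g = cong₂ _+_ (f≗g 0) (∑-cong n (f≗g ∘ suc))

∑-mono-≤ : ∀ n {f g} → (∀ x → f x ≤ g x) → ∑ n f ≤ ∑ n g
∑-mono-≤ zero    f≤g = z≤n
∑-mono-≤ (suc n) f≤g = +-mono-≤ (f≤g 0) (∑-mono-≤ n (f≤g ∘ suc))

∑-zero : ∀ n → ∑ n (λ _ → 0) ≡ 0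
∑-zero zero    = refl
∑-zero (suc n) = ∑-zero n

∑-+ : ∀ n f g → ∑ n (λ x → f x + g x) ≡ ∑ n f + ∑ n g
∑-+ zero    f g = refl
∑-+ (suc n) f g = trans (cong (λ z → f 0 + g 0 + z) (∑-+ n (f ∘ suc) (g ∘ suc)))
                        (interchange (f 0) (g 0) _ _)
  where
  interchange : ∀ a b c d → a + b + (c + d) ≡ a + c + (b + d)
  interchange = solve-∀

-- The sum over `0, …, n` peeled at either end. This is the index shift behind the telescoping of
-- floor sums.
∑-last : ∀ n f → f 0 + ∑ n (f ∘ suc) ≡ ∑ n f + f n
∑-last zero    f = +-identityʳ (f 0)
∑-last (suc n) f = trans (cong (_+_ (f 0)) (∑-last n (f ∘ suc))) (sym (+-assoc (f 0) _ _))

-- With `a = p′ - p` and `b = r′ - r` this is the triangle inequality: the change from `a` to `b` is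
-- at most the rise from `p` to `r` plus the rise from `p′` to `r′`. The additive form avoids
-- truncated subtraction, and summing it over `x` needs no side conditions.
∣-∣+≤ : ∀ {a b p r p′ r′} → a + p ≡ p′ → b + r ≡ r′ → p ≤ r → p′ ≤ r′ →
        ∣ a - b ∣ + (p + p′) ≤ r + r′
∣-∣+≤ {a} {b} {p} {r} refl refl p≤r p′≤r′ with ≤-total a b
... | inj₁ a≤b = begin
  ∣ a - b ∣ + (p + (a + p))  ≡⟨ cong (_+ (p + (a + p))) (m≤n⇒∣m-n∣≡n∸m a≤b) ⟩
  (b ∸ a) + (p + (a + p))    ≡⟨ rearrange (b ∸ a) p a ⟩
  p + ((b ∸ a + a) + p)      ≡⟨ cong (λ z → p + (z + p)) (m∸n+n≡m a≤b) ⟩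
  p + (b + p)                ≤⟨ +-mono-≤ p≤r (+-monoʳ-≤ b p≤r) ⟩
  r + (b + r)                ∎
  where
  open ≤-Reasoning
  rearrange : ∀ d p a → d + (p + (a + p)) ≡ p + ((d + a) + p)
  rearrange = solve-∀
... | inj₂ b≤a = begin
  ∣ a - b ∣ + (p + (a + p))  ≡⟨ cong (_+ (p + (a + p))) (m≤n⇒∣n-m∣≡n∸m b≤a) ⟩
  (a ∸ b) + (p + (a + p))    ≡⟨ sym (+-assoc (a ∸ b) p (a + p)) ⟩
  (a ∸ b + p) + (a + p)      ≤⟨ +-mono-≤ (+-cancelˡ-≤ b _ _ (begin
      b + (a ∸ b + p)          ≡⟨ sym (+-assoc b (a ∸ b) p) ⟩
      b + (a ∸ b) + p          ≡⟨ cong (_+ p) (m+[n∸m]≡n b≤a) ⟩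
      a + p                    ≤⟨ p′≤r′ ⟩
      b + r                    ∎)) p′≤r′ ⟩
  r + (b + r)                ∎
  where open ≤-Reasoning

[m+kn]/n≡m/n+k : ∀ m k n .{{_ : NonZero n}} → (m + k * n) / n ≡ m / n + k
[m+kn]/n≡m/n+k m k n = trans (+-distrib-/-∣ʳ m (divides-refl k)) (cong (m / n +_) (m*n/n≡m k n))

+-congˡ-% : ∀ a {x y} n .{{_ : NonZero n}} → x % n ≡ y % n → (a + x) % n ≡ (a + y) % n
+-congˡ-% a {x} {y} n eq = trans (%-distribˡ-+ a x n)
  (trans (cong (λ z → (a % n + z) % n) eq) (sym (%-distribˡ-+ a y n)))

*-congˡ-% : ∀ a {x y} n .{{_ : NonZero n}} → x % n ≡ y % n → (a * x) % n ≡ (a * y) % n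
*-congˡ-% a {x} {y} n eq = trans (%-distribˡ-* a x n)
  (trans (cong (λ z → (a % n * z) % n) eq) (sym (%-distribˡ-* a y n)))

-- Counting residues in a window by floor sums.

module Window (n q h : ℕ) .{{_ : NonZero n}} where

  -- 1 on the residues n - h, …, n - 1 and 0 on the others (for h ≤ n).
  χ : ℕ → ℕ
  χ y = (y % n + h) / n

  χ-cong : ∀ {x y} → x % n ≡ y % n → χ x ≡ χ y
  χ-cong = cong (λ r → (r + h) / n)

  -- Splitting `y` into its remainder and a multiple of `n` moves `y / n` out of the quotient. Thus
  -- `χ y` is a difference of two floors, and sums of `χ` become differences of values of
  -- `floorSum`.
  χ+/ : ∀ y → χ y + y / n ≡ (y + h) / n
  χ+/ y = begin
    (y % n + h) / n + y / n        ≡⟨ sym ([m+kn]/n≡m/n+k (y % n + h) (y / n) n) ⟩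
    (y % n + h + y / n * n) / n    ≡⟨ cong (_/ n) (swap (y % n) h _) ⟩
    (y % n + y / n * n + h) / n    ≡⟨ cong (λ z → (z + h) / n) (sym (m≡m%n+[m/n]*n y n)) ⟩
    (y + h) / n                    ∎
    where
    open ≡-Reasoning
    swap : ∀ a b c → a + b + c ≡ a + c + b
    swap = solve-∀

  χ≤1 : h ≤ n → ∀ y → χ y ≤ 1
  χ≤1 h≤n y = <⇒≤pred (m<n*o⇒m/o<n (subst (λ z → y % n + h < n + z) (sym (+-identityʳ n))
    (+-mono-<-≤ (m%n<n y n) h≤n)))

  floorSum : ℕ → ℕ
  floorSum c = ∑ n (λ x → (q * x + c) / n)

  -- Raising c by q shifts the summation index by one, so the sum telescopes.
  floorSum-shift : ∀ c → floorSum (q + c) ≡ q + floorSum c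
  floorSum-shift c = +-cancelˡ-≡ (f 0) _ _ (begin
    f 0 + floorSum (q + c)    ≡⟨ cong (f 0 +_) (∑-cong n (λ x → cong (_/ n) (step q x c))) ⟩
    f 0 + ∑ n (f ∘ suc)       ≡⟨ ∑-last n f ⟩
    floorSum c + f n          ≡⟨ cong (λ z → floorSum c + z / n) (turn q n c) ⟩
    floorSum c + (q * 0 + c + q * n) / n ≡⟨ cong (floorSum c +_) ([m+kn]/n≡m/n+k (q * 0 + c) q n) ⟩
    floorSum c + (f 0 + q)    ≡⟨ rearrange (floorSum c) (f 0) q ⟩
    f 0 + (q + floorSum c)    ∎)
    where
    open ≡-Reasoning
    f : ℕ → ℕ
    f x = (q * x + c) / n
    step : ∀ q x c → q * x + (q + c) ≡ q * suc x + c
    step = solve-∀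
    turn : ∀ q n c → q * n + c ≡ q * 0 + c + q * n
    turn = solve-∀
    rearrange : ∀ s a q → s + (a + q) ≡ a + (q + s)
    rearrange = solve-∀

  floorSum-shifts : ∀ j c → floorSum (j * q + c) ≡ j * q + floorSum c
  floorSum-shifts zero    c = refl
  floorSum-shifts (suc j) c = begin
    floorSum (q + j * q + c)    ≡⟨ cong floorSum (+-assoc q (j * q) c) ⟩
    floorSum (q + (j * q + c))  ≡⟨ floorSum-shift (j * q + c) ⟩
    q + floorSum (j * q + c)    ≡⟨ cong (q +_) (floorSum-shifts j c) ⟩
    q + (j * q + floorSum c)    ≡⟨ sym (+-assoc q (j * q) _) ⟩
    q + j * q + floorSum c      ∎
    where open ≡-Reasoning

  floorSum-mono : ∀ {c d} → c ≤ d → floorSum c ≤ floorSum d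
  floorSum-mono c≤d = ∑-mono-≤ n (λ x → /-monoˡ-≤ n (+-monoʳ-≤ (q * x) c≤d))

  -- The sum is `floorSum h - floorSum 0`, and `h` consists of exactly `u` shifts by `q`, each
  -- adding `q`. The count is therefore exact even where `x ↦ q * x` is not a bijection modulo `n`.
  ∑χ≡h : ∀ u → h ≡ u * q → ∑ n (λ x → χ (q * x)) ≡ h
  ∑χ≡h u h≡uq = +-cancelʳ-≡ (floorSum 0) _ _ (begin
    ∑ n (λ x → χ (q * x)) + floorSum 0                ≡⟨ sym (∑-+ n _ _) ⟩
    ∑ n (λ x → χ (q * x) + (q * x + 0) / n)           ≡⟨ ∑-cong n (λ x → trans
      (cong (λ z → χ (q * x) + z / n) (+-identityʳ (q * x))) (χ+/ (q * x))) ⟩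
    floorSum h                                        ≡⟨ cong floorSum (trans h≡uq (sym (+-identityʳ _))) ⟩
    floorSum (u * q + 0)                              ≡⟨ floorSum-shifts u 0 ⟩
    u * q + floorSum 0                                ≡⟨ cong (_+ floorSum 0) (sym h≡uq) ⟩
    h + floorSum 0                                    ∎)
    where open ≡-Reasoning

  -- Each end of the window contributes one floor. By `∣-∣+≤` the change of `χ` is at most the sum
  -- of the rises of the two floors when `e` is added. Summed over `x`, each rise is an increment of
  -- `floorSum` over a step `e`; monotonicity enlarges the step to `j * q`, where the increment is
  -- known exactly.
  variation : ∀ c {e} j → e ≤ j * q →
    ∑ n (λ x → ∣ χ (q * x + c) - χ (q * x + c + e) ∣) ≤ 2 * (j * q)
  variation c {e} j e≤jq = +-cancelʳ-≤ (floorSum c + floorSum (c + h)) _ _ (begin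
    ∑ n D + (floorSum c + floorSum (c + h))
      ≡⟨ cong (∑ n D +_) (sym (∑-+ n _ _)) ⟩
    ∑ n D + ∑ n (λ x → (q * x + c) / n + (q * x + (c + h)) / n)
      ≡⟨ sym (∑-+ n D _) ⟩
    ∑ n (λ x → D x + ((q * x + c) / n + (q * x + (c + h)) / n))
      ≤⟨ ∑-mono-≤ n pointwise ⟩
    ∑ n (λ x → (q * x + (e + c)) / n + (q * x + (e + (c + h))) / n)
      ≡⟨ ∑-+ n _ _ ⟩
    floorSum (e + c) + floorSum (e + (c + h))
      ≤⟨ +-mono-≤ (rise c) (rise (c + h)) ⟩
    (j * q + floorSum c) + (j * q + floorSum (c + h))
      ≡⟨ rearrange (j * q) _ _ ⟩
    2 * (j * q) + (floorSum c + floorSum (c + h)) ∎)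
    where
    open ≤-Reasoning
    D : ℕ → ℕ
    D x = ∣ χ (q * x + c) - χ (q * x + c + e) ∣
    rearrange : ∀ k s t → (k + s) + (k + t) ≡ 2 * k + (s + t)
    rearrange = solve-∀
    rise : ∀ d → floorSum (e + d) ≤ j * q + floorSum d
    rise d = ≤-trans (floorSum-mono (+-monoˡ-≤ d e≤jq)) (≤-reflexive (floorSum-shifts j d))
    comm₃ : ∀ y c e → y + c + e ≡ y + (e + c)
    comm₃ = solve-∀
    comm₄ : ∀ y c e h → y + c + e + h ≡ y + (e + (c + h))
    comm₄ = solve-∀
    pointwise : ∀ x → D x + ((q * x + c) / n + (q * x + (c + h)) / n) ≤
                      (q * x + (e + c)) / n + (q * x + (e + (c + h))) / n
    pointwise x = ∣-∣+≤
      (trans (χ+/ (q * x + c)) (cong (_/ n) (+-assoc (q * x) c h)))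
      (trans (cong (λ z → χ (q * x + c + e) + z / n) (sym (comm₃ (q * x) c e)))
        (trans (χ+/ (q * x + c + e)) (cong (_/ n) (comm₄ (q * x) c e h))))
      (/-monoˡ-≤ n (+-monoʳ-≤ (q * x) (m≤n+m c e)))
      (/-monoˡ-≤ n (+-monoʳ-≤ (q * x) (m≤n+m (c + h) e)))

  -- Replacing `x` by `x + s` moves the residue of `q * x` by `e` or by `- e`, so both cases reduce
  -- to `variation` with a suitable offset `c`.
  shift-variation : ∀ s {e} j → e ≤ j * q →
    (q * s) % n ≡ e % n ⊎ (q * s + e) % n ≡ 0 →
    ∑ n (λ x → ∣ χ (q * x) - χ (q * (x + s)) ∣) ≤ 2 * (j * q)
  shift-variation s {e} j e≤jq (inj₁ qs≡e) =
    subst (_≤ 2 * (j * q)) (∑-cong n λ x → cong₂ ∣_-_∣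
        (cong χ (+-identityʳ (q * x)))
        (χ-cong (trans (+-congˡ-% (q * x + 0) n (sym qs≡e))
          (cong (_% n) (expand q x s)))))
      (variation 0 j e≤jq)
    where
    expand : ∀ q x s → q * x + 0 + q * s ≡ q * (x + s)
    expand = solve-∀
  shift-variation s {e} j e≤jq (inj₂ qs+e≡0) =
    -- The backward move is read from its far end: starting at `q * (x + s)`, that is with offset
    -- `q * s`, adding `e` leads back to `q * x` modulo `n`.
    subst (_≤ 2 * (j * q)) (∑-cong n λ x → trans
        (∣-∣-comm (χ (q * x + q * s)) _)
        (cong₂ ∣_-_∣
          (χ-cong (trans (cong (_% n) (+-assoc (q * x) (q * s) e))
            (trans (+-congˡ-% (q * x) {y = 0} n (trans qs+e≡0 (sym (0%n≡0 n))))
              (cong (_% n) (+-identityʳ (q * x))))))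
          (cong χ (sym (*-distribˡ-+ q x s)))))
      (variation (q * s) j e≤jq)
    where
    0%n≡0 : ∀ n .{{_ : NonZero n}} → 0 % n ≡ 0
    0%n≡0 (suc _) = refl

-- Vertex sets made of whole spokes, and their boundaries.

levelSet : ∀ n → (ℕ → ℕ) → Subset n
levelSet n f = Vec.tabulate (λ i → does (f (toℕ i) ≟ 1))

∣levelSet∣≡∑ : ∀ n f → (∀ x → f x ≤ 1) → ∣ levelSet n f ∣ ≡ ∑ n f
∣levelSet∣≡∑ zero    f f≤1 = refl
∣levelSet∣≡∑ (suc n) f f≤1 with f 0 | f≤1 0 | ∣levelSet∣≡∑ n (f ∘ suc) (f≤1 ∘ suc)
... | 0           | _           | ih = ih
... | 1           | _           | ih = cong suc ih
... | suc (suc _) | s≤s ()      | _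

∣++∣≡∣∣+∣∣ : ∀ {m n} (F : Subset m) (G : Subset n) → ∣ F ++ G ∣ ≡ ∣ F ∣ + ∣ G ∣
∣++∣≡∣∣+∣∣ []          G = refl
∣++∣≡∣∣+∣∣ (false ∷ F) G = ∣++∣≡∣∣+∣∣ F G
∣++∣≡∣∣+∣∣ (true ∷ F)  G = cong suc (∣++∣≡∣∣+∣∣ F G)

crosses⇒lookup-≢ : ∀ {v} {F : Subset v} {x y} → Crosses F (x , y) → lookup F x ≢ lookup F y
crosses⇒lookup-≢ {F = F} {x} {y} (inj₁ (x∈F , y∉F)) eq =
  y∉F (lookup⇒[]= y F (trans (sym eq) ([]=⇒lookup x∈F)))
crosses⇒lookup-≢ {F = F} {x} {y} (inj₂ (x∉F , y∈F)) eq =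
  x∉F (lookup⇒[]= x F (trans eq ([]=⇒lookup y∈F)))

length-filter-tabulate≤∑ : ∀ {A : Set} {P : A → Set} (P? : Decidable P) n (f : Fin n → A) g →
  (∀ i → P (f i) → 1 ≤ g (toℕ i)) → length (filter P? (List.tabulate f)) ≤ ∑ n g
length-filter-tabulate≤∑ P? zero    f g P⇒1≤g = z≤n
length-filter-tabulate≤∑ P? (suc n) f g P⇒1≤g
  with P? (f Fin.zero) | length-filter-tabulate≤∑ P? n (f ∘ Fin.suc) (g ∘ suc) (P⇒1≤g ∘ Fin.suc)
... | yes p | ih = +-mono-≤ (P⇒1≤g Fin.zero p) ih
... | no  _ | ih = ≤-trans ih (m≤n+m _ (g 0))

-- A union of whole spokes cuts no spoke.
∣∂∣≤∑ : ∀ n k (f : ℕ → ℕ) .{{_ : NonZero n}} →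
  length (∂ (petersen n k) (levelSet n f ++ levelSet n f)) ≤
  ∑ n (λ x → ∣ f x - f ((x + 1) % n) ∣) + ∑ n (λ x → ∣ f x - f ((x + k) % n) ∣)
∣∂∣≤∑ n@(suc _) k f = begin
  length (∂ X F)
    ≡⟨ cong length (trans (filter-++ F? rim _) (cong (filter F? rim List.++_) (filter-++ F? spokes _))) ⟩
  length (filter F? rim List.++ filter F? spokes List.++ filter F? inner)
    ≡⟨ trans (length-++ (filter F? rim)) (cong (length (filter F? rim) +_) (length-++ (filter F? spokes))) ⟩
  length (filter F? rim) + (length (filter F? spokes) + length (filter F? inner))
    ≤⟨ +-mono-≤ (length-filter-tabulate≤∑ F? n rimEdge (g 1) (cut 1 (_↑ˡ n) lookup-a))
         (+-mono-≤ (length-filter-tabulate≤∑ F? n spoke (λ _ → 0)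
                      (λ i c → contradiction (trans (lookup-a i) (sym (lookup-b i))) (crosses⇒lookup-≢ c)))
                   (length-filter-tabulate≤∑ F? n innerEdge (g k) (cut k (n ↑ʳ_) lookup-b))) ⟩
  ∑ n (g 1) + (∑ n (λ _ → 0) + ∑ n (g k))
    ≡⟨ cong (λ z → ∑ n (g 1) + (z + ∑ n (g k))) (∑-zero n) ⟩
  ∑ n (g 1) + ∑ n (g k) ∎
  where
  open ≤-Reasoning
  X = petersen n k
  F = levelSet n f ++ levelSet n f
  F? = crosses? F
  rimEdge spoke innerEdge : Fin n → Fin (n + n) × Fin (n + n)
  rimEdge   i = i ↑ˡ n , (i ⊕ 1) ↑ˡ n
  spoke     i = i ↑ˡ n , n ↑ʳ i
  innerEdge i = n ↑ʳ i , n ↑ʳ (i ⊕ k)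
  rim    = List.tabulate rimEdge
  spokes = List.tabulate spoke
  inner  = List.tabulate innerEdge
  g : ℕ → ℕ → ℕ
  g s x = ∣ f x - f ((x + s) % n) ∣
  member : ℕ → Bool
  member x = does (f x ≟ 1)
  lookup-a : ∀ i → lookup F (i ↑ˡ n) ≡ member (toℕ i)
  lookup-a i = trans (lookup-++ˡ (levelSet n f) _ i) (lookup∘tabulate (member ∘ toℕ) i)
  lookup-b : ∀ i → lookup F (n ↑ʳ i) ≡ member (toℕ i)
  lookup-b i = trans (lookup-++ʳ (levelSet n f) _ i) (lookup∘tabulate (member ∘ toℕ) i)
  -- A zero summand forces equal values of `f` at the two ends, hence equal membership, whereas the
  -- ends of a crossing edge differ in membership.
  cut : ∀ s (v : Fin n → Fin (n + n)) → (∀ i → lookup F (v i) ≡ member (toℕ i)) →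
        ∀ i → Crosses F (v i , v (i ⊕ s)) → 1 ≤ g s (toℕ i)
  cut s v lookup-v i c = n≢0⇒n>0 λ g≡0 → crosses⇒lookup-≢ c
    (trans (lookup-v i) (trans (cong (λ z → does (z ≟ 1)) (trans (∣m-n∣≡0⇒m≡n {f (toℕ i)} g≡0)
        (cong f (sym (toℕ-fromℕ< (m%n<n (toℕ i + s) n))))))
      (sym (lookup-v (i ⊕ s)))))

-- Choice of the multiplier and of the window length.

-- The `m + 1` residues of `i * k` for `0 ≤ i ≤ m` are sorted into `m` bins, a residue `r` going to
-- bin `r * m / n`. Two of them share a bin; `q` is the difference of their indices and `e` the
-- distance between the residues. Which residue is larger decides the sign.
dirichlet : ∀ n k m .{{_ : NonZero n}} .{{_ : NonZero m}} →
  ∃[ q ] ∃[ e ] 1 ≤ q × q ≤ m × e * m < n ×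
    ((q * k) % n ≡ e % n ⊎ (q * k + e) % n ≡ 0)
dirichlet n k m with pigeonhole (n<1+n m) (λ i → fromℕ< (m<n*o⇒m/o<n (bin<m (toℕ i))))
  where
  bin<m : ∀ i → (i * k) % n * m < m * n
  bin<m i = subst ((i * k) % n * m <_) (*-comm n m) (*-monoˡ-< m (m%n<n (i * k) n))
... | i′ , j′ , i<j , same = toℕ j′ ∸ toℕ i′ , result
  where
  i = toℕ i′
  j = toℕ j′
  q = j ∸ i
  r : ℕ → ℕ
  r x = (x * k) % n
  same-bin : r i * m / n ≡ r j * m / n
  same-bin = trans (sym (toℕ-fromℕ< _)) (trans (cong toℕ same) (toℕ-fromℕ< _))

  -- Two multiples of `m` with the same quotient by `n` differ by less than `n`.
  close : ∀ {a b} → a ≤ b → a * m / n ≡ b * m / n → (b ∸ a) * m < n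
  close {a} {b} a≤b eq = +-cancelʳ-< (a * m / n * n) _ _ (begin-strict
    (b ∸ a) * m + a * m / n * n  ≤⟨ +-monoʳ-≤ ((b ∸ a) * m) (m/n*n≤m (a * m) n) ⟩
    (b ∸ a) * m + a * m          ≡⟨ sym (*-distribʳ-+ m (b ∸ a) a) ⟩
    (b ∸ a + a) * m              ≡⟨ cong (_* m) (m∸n+n≡m a≤b) ⟩
    b * m                        ≡⟨ m≡m%n+[m/n]*n (b * m) n ⟩
    b * m % n + b * m / n * n    <⟨ +-mono-<-≤ (m%n<n (b * m) n) (≤-reflexive (cong (_* n) (sym eq))) ⟩
    n + a * m / n * n            ∎)
    where open ≤-Reasoning

  qk+ik≡jk : q * k + (r i + i * k / n * n) ≡ r j + j * k / n * n
  qk+ik≡jk = begin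
    q * k + (r i + i * k / n * n) ≡⟨ cong (q * k +_) (sym (m≡m%n+[m/n]*n (i * k) n)) ⟩
    q * k + i * k                 ≡⟨ sym (*-distribʳ-+ k q i) ⟩
    (q + i) * k                   ≡⟨ cong (_* k) (m∸n+n≡m (<⇒≤ i<j)) ⟩
    j * k                         ≡⟨ m≡m%n+[m/n]*n (j * k) n ⟩
    r j + j * k / n * n           ∎
    where open ≡-Reasoning

  swap : ∀ a b c → a + (b + c) ≡ b + (a + c)
  swap = solve-∀

  result : ∃[ e ] 1 ≤ q × q ≤ m × e * m < n × ((q * k) % n ≡ e % n ⊎ (q * k + e) % n ≡ 0)
  result with ≤-total (r i) (r j)
  ... | inj₁ ri≤rj = r j ∸ r i , m<n⇒0<n∸m i<j , ≤-trans (m∸n≤m j i) (≤-pred (toℕ<n j′)) ,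
        close ri≤rj same-bin , inj₁ (begin
    (q * k) % n                     ≡⟨ sym ([m+kn]%n≡m%n (q * k) (i * k / n) n) ⟩
    (q * k + i * k / n * n) % n     ≡⟨ cong (_% n) (+-cancelˡ-≡ (r i) _ _ (trans (swap (r i) (q * k) _)
                                         (trans qk+ik≡jk (trans (cong (_+ j * k / n * n) (sym (m+[n∸m]≡n ri≤rj)))
                                           (+-assoc (r i) _ _))))) ⟩
    (r j ∸ r i + j * k / n * n) % n ≡⟨ [m+kn]%n≡m%n (r j ∸ r i) (j * k / n) n ⟩
    (r j ∸ r i) % n                 ∎)
    where open ≡-Reasoning
  -- Here `q * k` is congruent to `- e`, which is expressed in naturals as `q * k + e` being
  -- congruent to `0`.
  ... | inj₂ rj≤ri = r i ∸ r j , m<n⇒0<n∸m i<j , ≤-trans (m∸n≤m j i) (≤-pred (toℕ<n j′)) ,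
        close rj≤ri (sym same-bin) , inj₂ (begin
    (q * k + (r i ∸ r j)) % n                   ≡⟨ sym ([m+kn]%n≡m%n _ (i * k / n) n) ⟩
    (q * k + (r i ∸ r j) + i * k / n * n) % n   ≡⟨ cong (_% n) (+-cancelˡ-≡ (r j) _ _ (trans
        (regroup (r j) (q * k) (r i ∸ r j) _)
        (trans (cong (λ z → q * k + (z + i * k / n * n)) (m+[n∸m]≡n rj≤ri)) qk+ik≡jk))) ⟩
    (j * k / n * n) % n                         ≡⟨ m*n%n≡0 (j * k / n) n ⟩
    0                                           ∎)
    where
    open ≡-Reasoning
    regroup : ∀ a b c d → a + (b + c + d) ≡ b + (a + c + d)
    regroup = solve-∀

-- Supplies the multiple of `q` needed by `variation`. Taking `e / q + 1` overshoots by a full `q`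
-- when `q` divides `e`, which the bound `q + e` still allows.
roundUp : ∀ e q → 1 ≤ q → ∃[ j ] e ≤ j * q × j * q ≤ q + e
roundUp e q@(suc _) _ = suc (e / q) ,
  ≤-trans (≤-reflexive (m≡m%n+[m/n]*n e q)) (+-monoˡ-≤ (e / q * q) (m%n≤n e q)) ,
  +-monoʳ-≤ q (m/n*n≤m e q)

-- The largest multiple of `2 * q` not exceeding `n` misses `n` by less than `2 * q`. Since `u` is
-- at least `1`, that error is at most `2 * (u * q)` itself.
halfMultiple : ∀ n q → 1 ≤ q → 2 * q ≤ n → ∃[ u ] 2 * (u * q) ≤ n × n < 4 * (u * q)
halfMultiple n q@(suc _) _ 2q≤n = u , lower , upper
  where
  open ≤-Reasoning
  u = n / (2 * q)
  swap : ∀ u q → 2 * (u * q) ≡ u * (2 * q)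
  swap = solve-∀
  double : ∀ w → 2 * w + 2 * w ≡ 4 * w
  double = solve-∀
  lower : 2 * (u * q) ≤ n
  lower = ≤-trans (≤-reflexive (swap u q)) (m/n*n≤m n (2 * q))
  1≤u : 1 ≤ u
  1≤u = m≥n⇒m/n>0 2q≤n
  upper : n < 4 * (u * q)
  upper = begin-strict
    n                                   ≡⟨ m≡m%n+[m/n]*n n (2 * q) ⟩
    n % (2 * q) + u * (2 * q)           <⟨ +-monoˡ-< (u * (2 * q)) (m%n<n n (2 * q)) ⟩
    2 * q + u * (2 * q)                 ≡⟨ cong₂ _+_ (cong (2 *_) (sym (*-identityˡ q))) (sym (swap u q)) ⟩
    2 * (1 * q) + 2 * (u * q)           ≤⟨ +-monoˡ-≤ (2 * (u * q)) (*-monoʳ-≤ 2 (*-monoˡ-≤ q 1≤u)) ⟩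
    2 * (u * q) + 2 * (u * q)           ≡⟨ double (u * q) ⟩
    4 * (u * q)                         ∎

-- The sparse cut.

sparseCut : ∀ n k m → 2 ≤ m → m * m ≤ n →
  ∃[ F ] Admissible (petersen n k) F × length (∂ (petersen n k) F) * m < 12 * ∣ F ∣
sparseCut n k m 2≤m m²≤n =
  let instance
        _ = >-nonZero (≤-trans (s≤s z≤n) 2≤m)
        _ = >-nonZero (≤-trans (*-mono-≤ {1} {m} {1} (≤-trans (s≤s z≤n) 2≤m) (≤-trans (s≤s z≤n) 2≤m)) m²≤n)
      q , e , 1≤q , q≤m , em<n , qk≡±e = dirichlet n k m
      -- From `2 ≤ m` and `q ≤ m` one gets `2 * q ≤ m * m`; this leaves room for at least one
      -- multiple of `q` in half the cycle.
      2q≤n = ≤-trans (*-mono-≤ 2≤m q≤m) m²≤n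
      u , 2uq≤n , n<4uq = halfMultiple n q 1≤q 2q≤n
      j , e≤jq , jq≤q+e = roundUp e q 1≤q
  in build q e q≤m em<n qk≡±e u 2uq≤n n<4uq j e≤jq jq≤q+e
  where
  build : .{{_ : NonZero n}} → ∀ q e → q ≤ m → e * m < n →
    (q * k) % n ≡ e % n ⊎ (q * k + e) % n ≡ 0 →
    ∀ u → 2 * (u * q) ≤ n → n < 4 * (u * q) → ∀ j → e ≤ j * q → j * q ≤ q + e →
    ∃[ F ] Admissible (petersen n k) F × length (∂ (petersen n k) F) * m < 12 * ∣ F ∣
  build q e q≤m em<n qk≡±e u 2uq≤n n<4uq j e≤jq jq≤q+e =
    F , (0<∣F∣ , 2∣F∣≤2n) , (begin-strict
      length (∂ (petersen n k) F) * m     ≤⟨ *-monoˡ-≤ m ∣∂F∣≤ ⟩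
      (2 * q + 2 * (q + e)) * m           ≡⟨ expand q e m ⟩
      -- `q * m ≤ m * m ≤ n` bounds the first term, and the strictness comes from `e * m < n`.
      4 * (q * m) + 2 * (e * m)           <⟨ +-mono-≤-< (*-monoʳ-≤ 4 (≤-trans (*-monoˡ-≤ m q≤m) m²≤n))
                                                        (*-monoʳ-< 2 em<n) ⟩
      4 * n + 2 * n                       ≡⟨ collect n ⟩
      6 * n                               ≤⟨ *-monoʳ-≤ 6 (<⇒≤ n<4uq) ⟩
      6 * (4 * h)                         ≡⟨ redistribute h ⟩
      12 * (h + h)                        ≡⟨ cong (12 *_) (sym ∣F∣≡h+h) ⟩
      12 * ∣ F ∣                          ∎)
    where
    open ≤-Reasoning
    h = u * q
    open Window n q h
    expand : ∀ q e m → (2 * q + 2 * (q + e)) * m ≡ 4 * (q * m) + 2 * (e * m)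
    expand = solve-∀
    collect : ∀ n → 4 * n + 2 * n ≡ 6 * n
    collect = solve-∀
    redistribute : ∀ h → 6 * (4 * h) ≡ 12 * (h + h)
    redistribute = solve-∀
    double : ∀ h → 2 * (h + h) ≡ 2 * h + 2 * h
    double = solve-∀
    S = levelSet n (λ x → χ (q * x))
    F = S ++ S
    h≤n : h ≤ n
    h≤n = ≤-trans (m≤n*m h 2) 2uq≤n
    ∣F∣≡h+h : ∣ F ∣ ≡ h + h
    ∣F∣≡h+h = trans (∣++∣≡∣∣+∣∣ S S) (cong₂ _+_ ∣S∣≡h ∣S∣≡h)
      where
      ∣S∣≡h : ∣ S ∣ ≡ h
      ∣S∣≡h = trans (∣levelSet∣≡∑ n _ (λ x → χ≤1 h≤n (q * x))) (∑χ≡h u refl)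
    0<h : 0 < h
    0<h = *-cancelˡ-< 4 0 h (≤-<-trans z≤n n<4uq)
    0<∣F∣ : 0 < ∣ F ∣
    0<∣F∣ = subst (0 <_) (sym ∣F∣≡h+h) (≤-trans 0<h (m≤m+n h h))
    2∣F∣≤2n : 2 * ∣ F ∣ ≤ n + n
    2∣F∣≤2n = subst (_≤ n + n) (sym (trans (cong (2 *_) ∣F∣≡h+h) (double h))) (+-mono-≤ 2uq≤n 2uq≤n)
    -- Reducing the index modulo `n` is invisible to `χ`, which depends only on the residue.
    mod-shift : ∀ s → ∑ n (λ x → ∣ χ (q * x) - χ (q * ((x + s) % n)) ∣) ≡
                      ∑ n (λ x → ∣ χ (q * x) - χ (q * (x + s)) ∣)
    mod-shift s = ∑-cong n (λ x → cong (λ z → ∣ χ (q * x) - z ∣)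
      (χ-cong (*-congˡ-% q n (m%n%n≡m%n (x + s) n))))
    ∣∂F∣≤ : length (∂ (petersen n k) F) ≤ 2 * q + 2 * (q + e)
    ∣∂F∣≤ = ≤-trans (∣∂∣≤∑ n k (λ x → χ (q * x))) (+-mono-≤
      -- A rim edge moves the residue by `q` itself, so a single shift covers it. An inner edge
      -- moves it by `± e`, covered by `j` shifts.
      (≤-trans (≤-reflexive (mod-shift 1)) (≤-trans
        (shift-variation 1 1 (≤-reflexive (sym (*-identityˡ q))) (inj₁ (cong (_% n) (*-identityʳ q))))
        (≤-reflexive (cong (2 *_) (*-identityˡ q)))))
      (≤-trans (≤-reflexive (mod-shift k)) (≤-trans
        (shift-variation k j e≤jq qk≡±e)
        (*-monoʳ-≤ 2 jq≤q+e))))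

-- Comparison with the real bound through the rational `12 / m`.

_/⁺_ : (a b : ℕ) .{{_ : NonZero b}} → ℚ.ℚ
a /⁺ b = ℤ.+ a ℚ./ b

toℚᵘ-/⁺ : ∀ a b → ℚ.toℚᵘ (a /⁺ suc b) ℚᵘ.≃ ℚᵘ.mkℚᵘ (ℤ.+ a) b
toℚᵘ-/⁺ a b = ℚP.toℚᵘ-fromℚᵘ (ℚᵘ.mkℚᵘ (ℤ.+ a) b)

/⁺-mono-< : ∀ {a b c d} .{{_ : NonZero b}} .{{_ : NonZero d}} → a * d < c * b → a /⁺ b ℚ.< c /⁺ d
/⁺-mono-< {a} {suc b} {c} {suc d} lt = ℚP.toℚᵘ-cancel-<
  (ℚᵘP.<-respˡ-≃ (ℚᵘP.≃-sym (toℚᵘ-/⁺ a b)) (ℚᵘP.<-respʳ-≃ (ℚᵘP.≃-sym (toℚᵘ-/⁺ c d))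
    (ℚᵘ.*<* (subst₂ ℤ._<_ (ℤP.pos-* a (suc d)) (ℤP.pos-* c (suc b)) (ℤ.+<+ lt)))))

/⁺-* : ∀ a b c d .{{_ : NonZero b}} .{{_ : NonZero d}} →
  (a /⁺ b) ℚ.* (c /⁺ d) ≡ ((a * c) /⁺ (b * d)) {{m*n≢0 b d}}
/⁺-* a (suc b) c (suc d) = ℚP.toℚᵘ-injective (begin
  ℚ.toℚᵘ ((a /⁺ suc b) ℚ.* (c /⁺ suc d))               ≈⟨ ℚP.toℚᵘ-homo-* (a /⁺ suc b) (c /⁺ suc d) ⟩
  ℚ.toℚᵘ (a /⁺ suc b) ℚᵘ.* ℚ.toℚᵘ (c /⁺ suc d)         ≈⟨ ℚᵘP.*-cong (toℚᵘ-/⁺ a b) (toℚᵘ-/⁺ c d) ⟩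
  ℚᵘ.mkℚᵘ (ℤ.+ a) b ℚᵘ.* ℚᵘ.mkℚᵘ (ℤ.+ c) d             ≡⟨ cong (λ z → ℚᵘ.mkℚᵘ z (d + b * suc d)) (sym (ℤP.pos-* a c)) ⟩
  ℚᵘ.mkℚᵘ (ℤ.+ (a * c)) (d + b * suc d)                ≈⟨ ℚᵘP.≃-sym (toℚᵘ-/⁺ (a * c) (d + b * suc d)) ⟩
  ℚ.toℚᵘ ((a * c) /⁺ (suc b * suc d))                  ∎)
  where open ℚᵘP.≃-Reasoning

-- If `n < m * m`, then `m` lies in the upper cut of the root; that cut is open, so some rational
-- below `m` still exceeds the root, contradicting the integer part property `m ≤ √ n`. Positivity
-- of `m` enters because the upper cut of `√` contains only positive rationals.
⌊√n⌋²≤n : ∀ n .{{_ : NonZero ⌊√ n ⌋}} → ⌊√ n ⌋ * ⌊√ n ⌋ ≤ n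
⌊√n⌋²≤n n = ≮⇒≥ λ n<m² →
  let q , q<m , √n<q = upper-open (√ (fromℤ (ℤ.+ n))) {q = m /⁺ 1}
        ( /⁺-mono-< {0} {1} {m} {1} (≤-trans (>-nonZero⁻¹ m) (≤-reflexive (sym (*-identityʳ m))))
        , subst (n /⁺ 1 ℚ.<_) (sym (/⁺-* m 1 m 1)) (/⁺-mono-< {n} {1} {m * m} {1} (*-monoˡ-< 1 n<m²)))
  in proj₁ (proj₂ (integerPart√ n)) (q , √n<q , q<m)
  where m = ⌊√ n ⌋

-- 8/3 = 4 - 4/3 is the lower Leibniz bound for π, so the claim is 144 (m - 1) < 64 m².
12/m<√[24π/[m-1]] : ∀ m .{{_ : NonZero m}} .{{_ : NonZero (m ∸ 1)}} →
  Lower (√ ((24 · π) ÷ (m ∸ 1))) (12 /⁺ m)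
12/m<√[24π/[m-1]] m@(suc (suc t)) = inj₂ (1 , subst (ℚ._< leibnizSum 2) (sym product)
  (/⁺-mono-< {144 * suc t * 1} {m * m * 1 * 24} {8} {3}
    (subst (144 * suc t * 1 * 3 <_) (sym (slack t)) (m≤m+n (suc (144 * suc t * 1 * 3)) _))))
  where
  product : (12 /⁺ m) ℚ.* (12 /⁺ m) ℚ.* (suc t /⁺ 1) ℚ.* (1 /⁺ 24) ≡
            (144 * suc t * 1) /⁺ (m * m * 1 * 24)
  product = trans (cong (λ z → z ℚ.* (suc t /⁺ 1) ℚ.* (1 /⁺ 24)) (/⁺-* 12 m 12 m))
    (trans (cong (ℚ._* (1 /⁺ 24)) (/⁺-* 144 (m * m) (suc t) 1))
      (/⁺-* (144 * suc t) (m * m * 1) 1 24))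
  slack : ∀ t → 8 * (suc (suc t) * suc (suc t) * 1 * 24) ≡
          suc (144 * suc t * 1 * 3) + (192 * t * t + 336 * t + 335)
  slack = solve-∀

corollary2p6 : (n k : ℕ) (4≤n : 4 ≤ n) → 1 ≤ k → 2 * k ≤ n →
    let instance _ = ⌊√n⌋∸1-nonZero 4≤n in
    fromℚ (expandingConstant (petersen n k)) <ℝ √ ((24 · π) ÷ (⌊√ n ⌋ ∸ 1))
-- The rational `12 / m` separates the two reals: the sparse cut puts the expanding constant
-- strictly below it, and the Leibniz bound puts the root strictly above it.
corollary2p6 n k 4≤n _ _ = 12 /⁺ m , h<12/m , 12/m<√[24π/[m-1]] m
  where
  m = ⌊√ n ⌋
  2≤m : 2 ≤ m
  2≤m = m∸n≢0⇒n<m {m} {1} (≢-nonZero⁻¹ (m ∸ 1) {{⌊√n⌋∸1-nonZero 4≤n}})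
  instance
    m-nonZero : NonZero m
    m-nonZero = >-nonZero (≤-trans (s≤s z≤n) 2≤m)
    m∸1-nonZero : NonZero (m ∸ 1)
    m∸1-nonZero = ⌊√n⌋∸1-nonZero 4≤n
  h<12/m : expandingConstant (petersen n k) ℚ.< 12 /⁺ m
  h<12/m =
    let F , admissible@(0<∣F∣ , _) , ∣∂F∣m<12∣F∣ = sparseCut n k m 2≤m (⌊√n⌋²≤n n) in
    ℚP.≤-<-trans
      (proj₂ (expandingConstant-isMinimum (petersen n k)
        (≤-trans (≤-trans (s≤s (s≤s z≤n)) 4≤n) (m≤m+n n n))) (F , admissible))
      (/⁺-mono-< {length (∂ (petersen n k) F)} {∣ F ∣} {12} {m} {{>-nonZero 0<∣F∣}} ∣∂F∣m<12∣F∣)
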